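{- Strong p-reflexivity fails in general: there exist a language $L$, an $L$-algebra $\mathfrak A$ with universe $A$, and elements $a,b,d\in A$ with $d\neq b$ such that $a:b\approx_{\mathfrak A}a:d$.
   Context: Let $L$ be a language of algebras: a set of function symbols, each with an arity in $\mathbb N$ (constants are 0-ary function symbols); $L$ may be empty. Fix a countably infinite set $X$ of variables; $T_{L,X}$ is the set of $L$-terms over $X$, and $X(s)$ denotes the set of variables occurring in a term $s$. For an $L$-algebra $\mathfrak A$ with universe $A$, every term $s$ induces a function $s^{\mathfrak A}$, evaluated at assignments of elements of $A$ to variables. An arrow of $\mathfrak A$ is a pair $(a,b)\in A\times A$, written $a\to b$. The generalizations of an arrow $a\to b$ in $\mathfrak A$ are the pairs of arbitrary terms $s\to t$ with $s,t\in T_{L,X}$ such that there is an assignment $\sigma$ of elements of $A$ to the variables in $X(s)\cup X(t)$ with $s^{\mathfrak A}(\sigma)=a$ and $t^{\mathfrak A}(\sigma)=b$; their set is denoted $\uparrow_{\mathfrak A}(a\to b)$. For $L$-algebras $\mathfrak A,\mathfrak B$, an arrow $a\to b$ of $\mathfrak A$ and an arrow $c\to d$ of $\mathfrak B$, set $(a\to b)\uparrow_{(\mathfrak A,\mathfrak B)}(c\to d):=\uparrow_{\mathfrak A}(a\to b)\cap\uparrow_{\mathfrak B}(c\to d)$. A pair of terms $s\to t$ is trivial in $(\mathfrak A,\mathfrak B)$ if it belongs to $\uparrow_{\mathfrak A}(e)$ for every arrow $e$ of $\mathfrak A$ and to $\uparrow_{\mathfrak B}(e')$ for every arrow $e'$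 of $\mathfrak B$. We write $a\to b\lesssim_{(\mathfrak A,\mathfrak B)}c\to d$ iff either (i) every element of $\uparrow_{\mathfrak A}(a\to b)\cup\uparrow_{\mathfrak B}(c\to d)$ is trivial in $(\mathfrak A,\mathfrak B)$, or (ii) $(a\to b)\uparrow_{(\mathfrak A,\mathfrak B)}(c\to d)$ contains an element not trivial in $(\mathfrak A,\mathfrak B)$ and, for every arrow $c'\to d'$ of $\mathfrak B$, the inclusion $(a\to b)\uparrow_{(\mathfrak A,\mathfrak B)}(c\to d)\subseteq(a\to b)\uparrow_{(\mathfrak A,\mathfrak B)}(c'\to d')$ implies equality of these two sets. Define $a\to b\approx_{(\mathfrak A,\mathfrak B)}c\to d$ iff $a\to b\lesssim_{(\mathfrak A,\mathfrak B)}c\to d$ and $c\to d\lesssim_{(\mathfrak B,\mathfrak A)}a\to b$. For $a,b\in A$ and $c,d\in B$, the similarity-based analogical proportion $a:b\approx_{(\mathfrak A,\mathfrak B)}c:d$ holds iff $a\to b\approx_{(\mathfrak A,\mathfrak B)}c\to d$ and $b\to a\approx_{(\mathfrak A,\mathfrak B)}d\to c$. We write $\approx_{\mathfrak A}$ for $\approx_{(\mathfrak A,\mathfrak A)}$. -}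

module Defs where

open import Data.Nat using (ℕ)
open import Data.Product using (_×_; _,_; Σ-syntax; ∃-syntax)
open import Data.Sum using (_⊎_; inj₁; inj₂)
open import Data.Vec using (Vec; []; _∷_)
open import Data.Vec.Relation.Unary.Any using (Any; here; there)
open import Relation.Binary.PropositionalEquality using (_≡_)
open import Relation.Nullary using (¬_)
open import Relation.Unary using (Pred; _∈_; _∩_; _∪_; _⊆_; _≐_)
open import Level using (0ℓ)

record Language : Set₁ where
  field
    Symbol : Set
    arity  : Symbol → ℕ

open Language public

-- The fixed countably infinite set X of variables.
Var : Set
Var = ℕ

data Term (L : Language) : Set where
  var : Var → Term L
  app : (f : Symbol L) → Vec (Term L) (arity L f) → Term L

-- x OccursIn s  is  x ∈ X(s).
data _OccursIn_ {L : Language} (x : Var) : Term L → Set where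
  in-var : x OccursIn var x
  in-app : ∀ {f ts} → Any (x OccursIn_) ts → x OccursIn app f ts

record Algebra (L : Language) : Set₁ where
  field
    Carrier   : Set
    interpret : (f : Symbol L) → Vec Carrier (arity L f) → Carrier

open Algebra public

-- Assignments of elements of A to the variables satisfying V only.  The
-- membership proof is irrelevant, so the value depends on the variable alone
-- and not on the occurrence through which it is looked up.
Assignment : Pred Var 0ℓ → Set → Set
Assignment V A = (x : Var) → .(x ∈ V) → A

module _ {L : Language} (𝔄 : Algebra L) where

  eval  : (s : Term L) → Assignment (_OccursIn s) (Carrier 𝔄) → Carrier 𝔄
  evals : ∀ {n} (ts : Vec (Term L) n) →
          Assignment (λ x → Any (x OccursIn_) ts) (Carrier 𝔄) →
          Vec (Carrier 𝔄) n

  eval (var x)    σ = σ x in-var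
  eval (app f ts) σ = interpret 𝔄 f (evals ts (λ x p → σ x (in-app p)))

  evals []       σ = []
  evals (t ∷ ts) σ = eval t (λ x p → σ x (here p)) ∷ evals ts (λ x p → σ x (there p))

infix 5 _⟶_

record Arrow (A : Set) : Set where
  constructor _⟶_
  field
    source target : A

module _ {L : Language} where

  ↑ : (𝔄 : Algebra L) → Arrow (Carrier 𝔄) → Pred (Arrow (Term L)) 0ℓ
  ↑ 𝔄 (a ⟶ b) (s ⟶ t) =
    Σ[ σ ∈ Assignment ((_OccursIn s) ∪ (_OccursIn t)) (Carrier 𝔄) ]
      eval 𝔄 s (λ x p → σ x (inj₁ p)) ≡ a ×
      eval 𝔄 t (λ x p → σ x (inj₂ p)) ≡ b

  module _ (𝔄 𝔅 : Algebra L) where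

    -- e ↑_(𝔄,𝔅) e′
    CommonGen : Arrow (Carrier 𝔄) → Arrow (Carrier 𝔅) → Pred (Arrow (Term L)) 0ℓ
    CommonGen e e′ = ↑ 𝔄 e ∩ ↑ 𝔅 e′

    Trivial : Pred (Arrow (Term L)) 0ℓ
    Trivial g = (∀ e → g ∈ ↑ 𝔄 e) × (∀ e′ → g ∈ ↑ 𝔅 e′)

    -- e ≲_(𝔄,𝔅) e′
    ArrowLeq : Arrow (Carrier 𝔄) → Arrow (Carrier 𝔅) → Set
    ArrowLeq e e′ =
      (↑ 𝔄 e ∪ ↑ 𝔅 e′) ⊆ Trivial
      ⊎
      (∃[ g ] g ∈ CommonGen e e′ × ¬ (g ∈ Trivial)) ×
      (∀ e″ → CommonGen e e′ ⊆ CommonGen e e″ → CommonGen e e′ ≐ CommonGen e e″)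

  -- e ≈_(𝔄,𝔅) e′ for arrows
  ArrowSim : (𝔄 𝔅 : Algebra L) → Arrow (Carrier 𝔄) → Arrow (Carrier 𝔅) → Set
  ArrowSim 𝔄 𝔅 e e′ = ArrowLeq 𝔄 𝔅 e e′ × ArrowLeq 𝔅 𝔄 e′ e

  -- Proportion 𝔄 𝔅 a b c d  is  a : b ≈_(𝔄,𝔅) c : d.
  Proportion : (𝔄 𝔅 : Algebra L) → (a b : Carrier 𝔄) → (c d : Carrier 𝔅) → Set
  Proportion 𝔄 𝔅 a b c d =
    ArrowSim 𝔄 𝔅 (a ⟶ b) (c ⟶ d) × ArrowSim 𝔄 𝔅 (b ⟶ a) (d ⟶ c)

{-# OPTIONS --safe #-}
-- Over the empty language every term is a variable.  If a ≢ b, then every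
-- generalization of a ⟶ b is of the form x ⟶ y with distinct variables x and y,
-- and such a pair generalizes every arrow.  Hence all generalizations of a ⟶ b
-- are trivial, and any two arrows with distinct endpoints are similar by
-- clause (i).  Three elements suffice for distinct a, b, d.
module Submission where

open import Defs
open import Data.Bool using (if_then_else_)
open import Data.Empty using (⊥)
open import Data.Fin using (Fin; zero; suc)
open import Data.Nat using (_≟_)
open import Data.Product using (_×_; Σ-syntax; _,_)
open import Data.Sum using (inj₁; [_,_])
open import Relation.Binary.PropositionalEquality using (_≢_; refl; sym; trans; cong; ≢-sym)
open import Relation.Nullary using (does)
open import Relation.Nullary.Decidable using (dec-true; dec-false)
open import Relation.Unary using (_∈_)

emptyLanguage : Language
emptyLanguage = record { Symbol = ⊥ ; arity = λ () }

distinct-variables-generalize :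
  ∀ {L} (𝔄 : Algebra L) {x y} → x ≢ y → ∀ e → (var x ⟶ var y) ∈ ↑ 𝔄 e
distinct-variables-generalize 𝔄 {x} {y} x≢y (a ⟶ b) =
  -- Send `x` to the source and every other variable, in particular `y`, to the target.
  (λ z _ → if does (z ≟ x) then a else b) ,
  cong (if_then a else b) (dec-true (x ≟ x) refl) ,
  cong (if_then a else b) (dec-false (y ≟ x) (≢-sym x≢y))

module _ (𝔄 : Algebra emptyLanguage) where

  generalizations-trivial :
    ∀ {a b} → a ≢ b → ∀ g → g ∈ ↑ 𝔄 (a ⟶ b) → g ∈ Trivial 𝔄 𝔄
  -- No `app` case arises: its function symbol would inhabit `⊥`.
  generalizations-trivial a≢b (var x ⟶ var y) (σ , σx≡a , σy≡b) =
    distinct-variables-generalize 𝔄 x≢y , distinct-variables-generalize 𝔄 x≢y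
    where
    x≢y : x ≢ y
    -- Occurrence proofs are irrelevant in `σ`, so a variable shared by both sides has one value,
    -- forcing the endpoints to agree.
    x≢y refl = a≢b (trans (sym σx≡a) σy≡b)

  ≢⇒ArrowLeq : ∀ {a b c d} → a ≢ b → c ≢ d → ArrowLeq 𝔄 𝔄 (a ⟶ b) (c ⟶ d)
  ≢⇒ArrowLeq a≢b c≢d =
    inj₁ λ {g} → [ generalizations-trivial a≢b g , generalizations-trivial c≢d g ]

  ≢⇒Proportion : ∀ {a b c d} → a ≢ b → c ≢ d → Proportion 𝔄 𝔄 a b c d
  ≢⇒Proportion a≢b c≢d =
    (≢⇒ArrowLeq a≢b c≢d , ≢⇒ArrowLeq c≢d a≢b) ,
    (≢⇒ArrowLeq (≢-sym a≢b) (≢-sym c≢d) , ≢⇒ArrowLeq (≢-sym c≢d) (≢-sym a≢b))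

threeElementSet : Algebra emptyLanguage
threeElementSet = record { Carrier = Fin 3 ; interpret = λ () }

theorem3 : Σ[ L ∈ Language ] Σ[ 𝔄 ∈ Algebra L ] Σ[ a ∈ Carrier 𝔄 ] Σ[ b ∈ Carrier 𝔄 ] Σ[ d ∈ Carrier 𝔄 ]
    (d ≢ b × Proportion 𝔄 𝔄 a b a d)
theorem3 =
  emptyLanguage , threeElementSet , zero , suc zero , suc (suc zero) ,
  -- The absurd matches refute, in order, `d ≡ b`, `a ≡ b` and `a ≡ d`.
  (λ ()) , ≢⇒Proportion threeElementSet (λ ()) (λ ())
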